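{- For every finite simple graph $G$ with at least one vertex, $$\alpha_2(G)\geq Z_3(G)=\sum_{v\in V(G)}\min\left\{1,\frac{1}{\zeta(v)+\frac13}\right\}.$$
   Context: For an integer $k\geq 0$, a $k$-independent set of $G$ is a set $S\subseteq V(G)$ with $\Delta(G[S])\leq k$, and $\alpha_k(G)$ is the maximum cardinality of a $k$-independent set. For a vertex $v$, $\zeta(v)=\max_H\delta(H)$, the maximum over all subgraphs $H$ of $G$ containing $v$, where $\delta(H)$ is the minimum degree. -}

module Defs where

open import Data.Nat using (ℕ; zero; suc; _+_; _*_; _≤_)
open import Data.Bool using (Bool; true; false; T)
open import Data.Fin using (Fin)
open import Data.List using (List; length; filter; allFin; map; foldr)
open import Data.Product using (Σ; ∃; _×_; _,_)
open import Relation.Binary.PropositionalEquality using (_≡_)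
open import Relation.Nullary using (¬_)
open import Relation.Nullary.Decidable using (T?)
open import Data.Integer using (+_)
open import Data.Rational using (ℚ; _/_; _⊓_) renaming (_+_ to _+ℚ_; 0ℚ to 0ℚ; 1ℚ to 1ℚ)

record Graph (n : ℕ) : Set where
  field
    adj     : Fin n → Fin n → Bool
    sym     : ∀ u w → adj u w ≡ adj w u
    irrefl  : ∀ u → adj u u ≡ false
open Graph public

count : {n : ℕ} → (Fin n → Bool) → ℕ
count {n} P = length (filter (λ w → T? (P w)) (allFin n))

VSet : ℕ → Set
VSet n = Fin n → Bool

_∈_ : {n : ℕ} → Fin n → VSet n → Set
u ∈ S = T (S u)

record Subgraph {n : ℕ} (G : Graph n) : Set where
  field
    verts    : VSet n
    edges    : Fin n → Fin n → Bool
    edge-sym : ∀ u w → edges u w ≡ edges w u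
    edge-G   : ∀ u w → T (edges u w) → T (adj G u w)
    edge-V   : ∀ u w → T (edges u w) → (u ∈ verts) × (w ∈ verts)
open Subgraph public

degH : {n : ℕ} {G : Graph n} → Subgraph G → Fin n → ℕ
degH H u = count (λ w → edges H u w)

IsMinDeg : {n : ℕ} {G : Graph n} → Subgraph G → ℕ → Set
IsMinDeg H d = (∀ u → u ∈ verts H → d ≤ degH H u)
             × (Σ (Fin _) λ u → (u ∈ verts H) × (degH H u ≡ d))

IsZeta : {n : ℕ} → Graph n → Fin n → ℕ → Set
IsZeta G v z = (Σ (Subgraph G) λ H → (v ∈ verts H) × IsMinDeg H z)
             × (∀ (H : Subgraph G) d → v ∈ verts H → IsMinDeg H d → d ≤ z)

degInduced : {n : ℕ} → Graph n → VSet n → Fin n → ℕ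
degInduced G S u = count (λ w → Data.Bool._∧_ (S w) (adj G u w))

IsKIndependent : {n : ℕ} → ℕ → Graph n → VSet n → Set
IsKIndependent k G S = ∀ u → u ∈ S → degInduced G S u ≤ k

IsAlpha : {n : ℕ} → ℕ → Graph n → ℕ → Set
IsAlpha k G a = (Σ (VSet _) λ S → IsKIndependent k G S × (count S ≡ a))
              × (∀ S → IsKIndependent k G S → count S ≤ a)

-- min{1, 1/(z + 1/3)} = min{1, 3/(3z+1)}
Z3term : ℕ → ℚ
Z3term z = 1ℚ ⊓ ((+ 3) / suc (3 * z))

Z3 : {n : ℕ} → (Fin n → ℕ) → ℚ
Z3 {n} ζ = foldr _+ℚ_ 0ℚ (map (λ v → Z3term (ζ v)) (allFin n))

{-# OPTIONS --safe #-}
module Submission where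

-- Removing minimum-degree vertices one by one orders V(G) so that, for some
-- level z ≤ ζ that is nondecreasing along the order, every v has at most z(v)
-- later neighbours.  These properties survive passing to a vertex subset R, so
-- by induction on |R| some 2-independent S ⊆ R has |S| ≥ Σ_{v ∈ R} W(z(v)),
-- where W(z) = min{1, 1/(z + 1/3)}.
--
-- Let x be the first vertex of R whose arrival creates a path on three vertices
-- (if there is none, take S = R), put d = z(x), and let X be the union of the
-- components, among the earlier vertices, that contain a neighbour of x.  Each
-- such component is a vertex or an edge, so X is 1-independent.  Put Q = X if
-- |X| ≥ 3 and Q = X ∪ {x} if |X| = 2, and delete Q together with its neighbours,
-- a set U; outside Q these have level ≥ d.  In units of 1/(d + 1/3), a vertex of
-- Q weighs at most d + 1 − z and the others at most 1.  Counting edges from Q to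
-- later vertices (X ∪ {x} alone spans at least |X| of them) bounds Σ_Q z from
-- below and shows that U weighs at most |Q|.

open import Defs renaming (sym to adj-sym; irrefl to adj-irrefl)
import Algebra.Properties.CommutativeMonoid.Sum as Sum
open import Data.Bool using (Bool; true; false; T; not; _∧_; _∨_; if_then_else_)
open import Data.Bool.Properties using (T-∧; T-∨)
open import Data.Empty using (⊥-elim)
open import Data.Fin using (Fin; zero; suc)
open import Data.Fin.Properties using (_≟_; any?)
import Data.Integer as ℤ
import Data.Integer.Properties as ℤ
open import Data.List using (length; filter; tabulate; map; foldr)
open import Data.Nat using (ℕ; zero; suc; _+_; _*_; _∸_; _⊔_; _<ᵇ_; _≤_; _<_; z≤n; s≤s)
open import Data.Nat.Properties hiding (_≟_)
open import Data.Nat.Solver using (module +-*-Solver)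
open import Data.Product using (∃; ∃₂; _×_; _,_; proj₁; proj₂)
open import Data.Rational as ℚ using (ℚ; _/_; 0ℚ; 1ℚ; toℚᵘ)
import Data.Rational.Properties as ℚ
open import Data.Rational.Unnormalised as ℚᵘ using (mkℚᵘ; *≤*; *≡*)
import Data.Rational.Unnormalised.Properties as ℚᵘ
open import Data.Sum using (_⊎_; inj₁; inj₂; [_,_])
open import Function using (_∘_; Equivalence)
open import Relation.Binary.Definitions using (tri<; tri≈; tri>)
open import Relation.Binary.PropositionalEquality using (_≡_; _≢_; refl; sym; trans; cong; cong₂; subst; subst₂; module ≡-Reasoning)
open import Relation.Nullary using (¬_; Dec; yes; no; does; contradiction)
open import Relation.Nullary.Decidable using (T?; _×-dec_; _⊎-dec_; ¬?)
open import Relation.Unary using (Decidable)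
open +-*-Solver using (solve; con; _:*_; _:+_; _:=_)
open Sum +-0-commutativeMonoid using (sum; sum-syntax; ∑-distrib-+; ∑-comm; sum-cong-≗)
open Sum ℚ.+-0-commutativeMonoid using () renaming (sum to sumℚ; ∑-distrib-+ to ∑ℚ-distrib-+; sum-cong-≗ to sumℚ-cong-≗)

private
  variable
    n : ℕ

-- Indicator sums and cardinalities

⟦_⟧ : Bool → ℕ
⟦ true ⟧  = 1
⟦ false ⟧ = 0

T⇒⟦⟧≥1 : ∀ {b} → T b → 1 ≤ ⟦ b ⟧
T⇒⟦⟧≥1 {true} _ = s≤s z≤n

⟦⟧-mono : ∀ {b c} → (T b → T c) → ⟦ b ⟧ ≤ ⟦ c ⟧
⟦⟧-mono {true}  b⇒c = T⇒⟦⟧≥1 (b⇒c _)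
⟦⟧-mono {false} b⇒c = z≤n

T∧ : ∀ {b c} → T b → T c → T (b ∧ c)
T∧ p q = Equivalence.from T-∧ (p , q)

T∧ˡ : ∀ b {c} → T (b ∧ c) → T b
T∧ˡ true _ = _

T∧ʳ : ∀ b {c} → T (b ∧ c) → T c
T∧ʳ true p = p

T∨⁺ : ∀ b {c} → T b ⊎ T c → T (b ∨ c)
T∨⁺ b = Equivalence.from (T-∨ {b})

T∨⁻ : ∀ b {c} → T (b ∨ c) → T b ⊎ T c
T∨⁻ b = Equivalence.to (T-∨ {b})

T-not⁻ : ∀ {b} → T (not b) → ¬ T b
T-not⁻ {false} _ ()

T-not⁺ : ∀ {b} → ¬ T b → T (not b)
T-not⁺ {true}  ¬b = ¬b _
T-not⁺ {false} ¬b = _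

T-does⁺ : ∀ {a} {A : Set a} (A? : Dec A) → A → T (does A?)
T-does⁺ (yes _) _ = _
T-does⁺ (no ¬a) a = ¬a a

T-does⁻ : ∀ {a} {A : Set a} (A? : Dec A) → T (does A?) → A
T-does⁻ (yes a) _ = a

∑-mono-≤ : {f g : Fin n → ℕ} → (∀ i → f i ≤ g i) → sum f ≤ sum g
∑-mono-≤ {zero}  f≤g = z≤n
∑-mono-≤ {suc n} f≤g = +-mono-≤ (f≤g zero) (∑-mono-≤ (f≤g ∘ suc))

term≤∑ : (f : Fin n → ℕ) (i : Fin n) → f i ≤ sum f
term≤∑ f zero    = m≤m+n _ _
term≤∑ f (suc i) = ≤-trans (term≤∑ (f ∘ suc) i) (m≤n+m _ (f zero))

∑-zero : ∑[ i < n ] 0 ≡ 0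
∑-zero {zero}  = refl
∑-zero {suc n} = ∑-zero {n}

∑-*ˡ : ∀ k (f : Fin n → ℕ) → ∑[ i < n ] (k * f i) ≡ k * sum f
∑-*ˡ {zero}  k f = sym (*-zeroʳ k)
∑-*ˡ {suc n} k f = trans (cong (k * f zero +_) (∑-*ˡ k (f ∘ suc))) (sym (*-distribˡ-+ k (f zero) _))

length-filter-tabulate : ∀ {m} (P : Fin n → Bool) (f : Fin m → Fin n) →
  length (filter (λ w → T? (P w)) (tabulate f)) ≡ ∑[ i < m ] ⟦ P (f i) ⟧
length-filter-tabulate {m = zero}  P f = refl
length-filter-tabulate {m = suc m} P f with P (f zero)
... | true  = cong suc (length-filter-tabulate P (f ∘ suc))
... | false = length-filter-tabulate P (f ∘ suc)

count≡∑ : (P : VSet n) → count P ≡ ∑[ i < n ] ⟦ P i ⟧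
count≡∑ P = length-filter-tabulate P (λ i → i)

count-mono : {P Q : VSet n} → (∀ i → i ∈ P → i ∈ Q) → count P ≤ count Q
count-mono {P = P} {Q} P⊆Q rewrite count≡∑ P | count≡∑ Q = ∑-mono-≤ (λ i → ⟦⟧-mono (P⊆Q i))

_≡ᶠ_ : Fin n → Fin n → Bool
i ≡ᶠ j = does (i ≟ j)

∑-δ : (i : Fin n) → ∑[ j < n ] ⟦ i ≡ᶠ j ⟧ ≡ 1
∑-δ {suc n} zero    = cong suc (∑-zero {n})
∑-δ {suc n} (suc i) = ∑-δ i

count-unique : (P : VSet n) → (∀ i j → i ∈ P → j ∈ P → i ≡ j) → count P ≤ 1
count-unique {n} P unique with any? (λ i → T? (P i))
... | yes (i , i∈P) = begin
  count P              ≡⟨ count≡∑ P ⟩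
  sum (⟦_⟧ ∘ P)        ≤⟨ ∑-mono-≤ (λ j → ⟦⟧-mono (T-does⁺ (i ≟ j) ∘ unique i j i∈P)) ⟩
  sum (⟦_⟧ ∘ (i ≡ᶠ_))  ≡⟨ ∑-δ i ⟩
  1                    ∎
  where open ≤-Reasoning
... | no ∄ = begin
  count P            ≡⟨ count≡∑ P ⟩
  sum (⟦_⟧ ∘ P)      ≤⟨ ∑-mono-≤ {g = λ _ → 0} (λ j → ⟦⟧-mono {c = false} (λ j∈P → ∄ (j , j∈P))) ⟩
  ∑[ j < n ] 0       ≡⟨ ∑-zero {n} ⟩
  0                  ≤⟨ z≤n ⟩
  1                  ∎
  where open ≤-Reasoning

∈⇒1≤count : (P : VSet n) {i : Fin n} → i ∈ P → 1 ≤ count P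
∈⇒1≤count P {i} i∈P rewrite count≡∑ P = ≤-trans (T⇒⟦⟧≥1 i∈P) (term≤∑ (⟦_⟧ ∘ P) i)

infixl 6 _∖_

_∖_ : VSet n → VSet n → VSet n
(P ∖ Q) i = P i ∧ not (Q i)

count-∖ : {P Q : VSet n} → (∀ i → i ∈ Q → i ∈ P) → count P ≡ count Q + count (P ∖ Q)
count-∖ {P = P} {Q} Q⊆P rewrite count≡∑ P | count≡∑ Q | count≡∑ (P ∖ Q) =
  trans (sum-cong-≗ pointwise) (∑-distrib-+ (⟦_⟧ ∘ Q) (⟦_⟧ ∘ (P ∖ Q)))
  where
  pointwise : ∀ i → ⟦ P i ⟧ ≡ ⟦ Q i ⟧ + ⟦ (P ∖ Q) i ⟧
  pointwise i with P i | Q i | Q⊆P i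
  ... | true  | true  | _ = refl
  ... | true  | false | _ = refl
  ... | false | true  | h = ⊥-elim (h _)
  ... | false | false | _ = refl

count-remove : (P : VSet n) {i : Fin n} → i ∈ P → suc (count (P ∖ (i ≡ᶠ_))) ≡ count P
count-remove P {i} i∈P =
  trans (cong (_+ count (P ∖ (i ≡ᶠ_))) (sym (trans (count≡∑ (i ≡ᶠ_)) (∑-δ i))))
        (sym (count-∖ (λ j i≡j → subst (_∈ P) (T-does⁻ (i ≟ j) i≡j) i∈P)))

distinct⇒2≤count : (P : VSet n) {i j : Fin n} → i ≢ j → i ∈ P → j ∈ P → 2 ≤ count P
distinct⇒2≤count P {i} {j} i≢j i∈P j∈P = ≤-trans
  (s≤s (∈⇒1≤count (P ∖ (i ≡ᶠ_)) (T∧ j∈P (T-not⁺ (i≢j ∘ T-does⁻ (i ≟ j))))))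
  (≤-reflexive (count-remove P i∈P))

⟦⟧-cover : ∀ {a b} c → (T c → T a ⊎ T b) → ⟦ c ⟧ ≤ ⟦ a ⟧ + ⟦ b ⟧
⟦⟧-cover         false _ = z≤n
⟦⟧-cover {a}     true  h with h _
... | inj₁ p = ≤-trans (T⇒⟦⟧≥1 p) (m≤m+n _ _)
... | inj₂ q = ≤-trans (T⇒⟦⟧≥1 q) (m≤n+m _ ⟦ a ⟧)

⟦⟧-disjoint : ∀ a b {c} → (T a → T c) → (T b → T c) → (T a → ¬ T b) → ⟦ a ⟧ + ⟦ b ⟧ ≤ ⟦ c ⟧
⟦⟧-disjoint false b     a⇒c b⇒c _    = ⟦⟧-mono b⇒c
⟦⟧-disjoint true  true  a⇒c b⇒c a⇒¬b = contradiction _ (a⇒¬b _)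
⟦⟧-disjoint true  false a⇒c b⇒c _    = T⇒⟦⟧≥1 (a⇒c _)

-- Serves twice: for a vertex of minimum degree in an induced subgraph and for the bad vertex of
-- least rank.
argmin : {P : Fin n → Set} → Decidable P → (f : Fin n → ℕ) →
  (∀ i → ¬ P i) ⊎ (∃ λ i → P i × (∀ j → P j → f i ≤ f j))
argmin {zero}  P? f = inj₁ λ ()
argmin {suc n} {P} P? f with P? zero | argmin (P? ∘ suc) (f ∘ suc)
... | no ¬p₀ | inj₁ none = inj₁ λ { zero → ¬p₀ ; (suc i) → none i }
... | no ¬p₀ | inj₂ (i , pᵢ , least) =
  inj₂ (suc i , pᵢ , λ { zero p₀ → contradiction p₀ ¬p₀ ; (suc j) → least j })
... | yes p₀ | inj₁ none =
  inj₂ (zero , p₀ , λ { zero _ → ≤-refl ; (suc j) pⱼ → contradiction pⱼ (none j) })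
... | yes p₀ | inj₂ (i , pᵢ , least) with ≤-total (f zero) (f (suc i))
...   | inj₁ f₀≤fᵢ = inj₂ (zero , p₀ , λ { zero _ → ≤-refl ; (suc j) pⱼ → ≤-trans f₀≤fᵢ (least j pⱼ) })
...   | inj₂ fᵢ≤f₀ = inj₂ (suc i , pᵢ , λ { zero _ → fᵢ≤f₀ ; (suc j) → least j })

∑∑-distrib-+ : (g h : Fin n → Fin n → ℕ) →
  ∑[ u < n ] ∑[ v < n ] (g u v + h u v) ≡ ∑[ u < n ] ∑[ v < n ] g u v + ∑[ u < n ] ∑[ v < n ] h u v
∑∑-distrib-+ g h = trans (sum-cong-≗ (λ u → ∑-distrib-+ (g u) (h u)))
                         (∑-distrib-+ (λ u → sum (g u)) (λ u → sum (h u)))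

-- The degeneracy order

induced : (G : Graph n) → VSet n → Subgraph G
induced G R = record
  { verts    = R
  ; edges    = λ u w → R u ∧ R w ∧ adj G u w
  ; edge-sym = edge-sym′
  ; edge-G   = λ u w → T∧ʳ (R w) ∘ T∧ʳ (R u)
  ; edge-V   = λ u w e → T∧ˡ (R u) e , T∧ˡ (R w) (T∧ʳ (R u) e)
  }
  where
  edge-sym′ : ∀ u w → R u ∧ R w ∧ adj G u w ≡ R w ∧ R u ∧ adj G w u
  edge-sym′ u w rewrite adj-sym G u w with R u | R w
  ... | true  | true  = refl
  ... | true  | false = refl
  ... | false | true  = refl
  ... | false | false = refl

-- In the construction below, `level` is the running maximum of the minimum degrees met so far.
-- `lower` hands this maximum to the recursive call, which makes the levels nondecreasing.
record DegeneracyOrder (G : Graph n) (ζ : Fin n → ℕ) (R : VSet n) (lower : ℕ) : Set where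
  field
    rank           : Fin n → ℕ
    level          : Fin n → ℕ
    rank-injective : ∀ {u v} → u ∈ R → v ∈ R → rank u ≡ rank v → u ≡ v
    level-mono     : ∀ {u v} → u ∈ R → v ∈ R → rank u ≤ rank v → level u ≤ level v
    later-degree   : ∀ {u} → u ∈ R → count (λ w → R w ∧ adj G u w ∧ (rank u <ᵇ rank w)) ≤ level u
    lower≤level    : ∀ {u} → u ∈ R → lower ≤ level u
    level≤ζ        : ∀ {u} → u ∈ R → level u ≤ ζ u

-- A vertex of minimum degree in the induced graph goes first. That graph contains every remaining
-- vertex, so its minimum degree is at most each of their `ζ`. The bound `k` on the size drives the
-- recursion.
degeneracyOrder : (G : Graph n) (ζ : Fin n → ℕ) →
  (∀ v (H : Subgraph G) d → v ∈ verts H → IsMinDeg H d → d ≤ ζ v) →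
  ∀ k R lower → count R ≤ k → (∀ {u} → u ∈ R → lower ≤ ζ u) → DegeneracyOrder G ζ R lower
degeneracyOrder {n} G ζ δ≤ζ k R lower |R|≤k lower≤ζ with argmin (λ u → T? (R u)) (degH (induced G R))
... | inj₁ R-empty = record
  { rank           = λ _ → 0
  ; level          = λ _ → 0
  ; rank-injective = λ {u} u∈R → contradiction u∈R (R-empty u)
  ; level-mono     = λ {u} u∈R → contradiction u∈R (R-empty u)
  ; later-degree   = λ {u} u∈R → contradiction u∈R (R-empty u)
  ; lower≤level    = λ {u} u∈R → contradiction u∈R (R-empty u)
  ; level≤ζ        = λ {u} u∈R → contradiction u∈R (R-empty u)
  }
... | inj₂ (v , v∈R , v-least) with k
...   | zero   = contradiction (≤-trans (∈⇒1≤count R v∈R) |R|≤k) λ ()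
...   | suc k′ = record
  { rank           = rank
  ; level          = level
  ; rank-injective = rank-injective
  ; level-mono     = level-mono
  ; later-degree   = later-degree
  ; lower≤level    = lower≤level
  ; level≤ζ        = level≤ζ
  }
  where
  d lower′ : ℕ
  d = degH (induced G R) v
  lower′ = lower ⊔ d

  lower′≤ζ : ∀ {u} → u ∈ R → lower′ ≤ ζ u
  lower′≤ζ {u} u∈R =
    ⊔-lub (lower≤ζ u∈R) (δ≤ζ u (induced G R) d u∈R (v-least , v , v∈R , refl))

  R′ : VSet n
  R′ = R ∖ (v ≡ᶠ_)

  |R′|≤k′ : count R′ ≤ k′
  |R′|≤k′ = ≤-pred (≤-trans (≤-reflexive (count-remove R v∈R)) |R|≤k)

  open DegeneracyOrder
    (degeneracyOrder G ζ δ≤ζ k′ R′ lower′ |R′|≤k′ (λ {u} → lower′≤ζ ∘ T∧ˡ (R u)))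
    renaming ( rank to rank′; level to level′; rank-injective to rank′-injective
             ; level-mono to level′-mono; later-degree to later-degree′
             ; lower≤level to lower′≤level′; level≤ζ to level′≤ζ )

  ∈R′ : ∀ {u} → u ∈ R → v ≢ u → u ∈ R′
  ∈R′ {u} u∈R v≢u = T∧ u∈R (T-not⁺ (v≢u ∘ T-does⁻ (v ≟ u)))

  rank level : Fin n → ℕ
  rank u  = if v ≡ᶠ u then 0 else suc (rank′ u)
  level u = if v ≡ᶠ u then lower′ else level′ u

  rank-injective : ∀ {u w} → u ∈ R → w ∈ R → rank u ≡ rank w → u ≡ w
  rank-injective {u} {w} u∈R w∈R eq with v ≟ u | v ≟ w
  ... | yes refl | yes refl = refl
  ... | no v≢u   | no v≢w   = rank′-injective (∈R′ u∈R v≢u) (∈R′ w∈R v≢w) (suc-injective eq)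

  level-mono : ∀ {u w} → u ∈ R → w ∈ R → rank u ≤ rank w → level u ≤ level w
  level-mono {u} {w} u∈R w∈R le with v ≟ u | v ≟ w
  ... | yes _  | yes _  = ≤-refl
  ... | yes _  | no v≢w = lower′≤level′ (∈R′ w∈R v≢w)
  ... | no v≢u | no v≢w = level′-mono (∈R′ u∈R v≢u) (∈R′ w∈R v≢w) (≤-pred le)

  later-degree : ∀ {u} → u ∈ R → count (λ w → R w ∧ adj G u w ∧ (rank u <ᵇ rank w)) ≤ level u
  later-degree {u} u∈R with v ≟ u
  -- The later neighbours of `v` are among its neighbours in `R`, of which there are `d`.
  ... | yes refl = ≤-trans
    (count-mono (λ w w∈ → T∧ v∈R (T∧ {R w} (T∧ˡ (R w) w∈) (T∧ˡ (adj G v w) (T∧ʳ (R w) w∈)))))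
    (m≤n⊔m lower d)
  ... | no v≢u = ≤-trans (count-mono later⇒later′) (later-degree′ (∈R′ u∈R v≢u))
    where
    later⇒later′ : ∀ w → T (R w ∧ adj G u w ∧ (suc (rank′ u) <ᵇ rank w)) →
      T (R′ w ∧ adj G u w ∧ (rank′ u <ᵇ rank′ w))
    later⇒later′ w w∈ with v ≟ w
    -- Here `w` is the removed vertex, whose rank 0 exceeds no other rank.
    ... | yes _  = ⊥-elim (T∧ʳ (adj G u w) (T∧ʳ (R w) w∈))
    ... | no v≢w = T∧ {R w ∧ true} (T∧ {R w} (T∧ˡ (R w) w∈) _) (T∧ʳ (R w) w∈)

  lower≤level : ∀ {u} → u ∈ R → lower ≤ level u
  lower≤level {u} u∈R with v ≟ u
  ... | yes _  = m≤m⊔n lower d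
  ... | no v≢u = ≤-trans (m≤m⊔n lower d) (lower′≤level′ (∈R′ u∈R v≢u))

  level≤ζ : ∀ {u} → u ∈ R → level u ≤ ζ u
  level≤ζ {u} u∈R with v ≟ u
  ... | yes _  = lower′≤ζ u∈R
  ... | no v≢u = level′≤ζ (∈R′ u∈R v≢u)

-- Reducible configurations

module Reduction
  (G : Graph n) (rank level : Fin n → ℕ)
  (rank-injective : ∀ {u v} → rank u ≡ rank v → u ≡ v)
  (level-mono : ∀ {u v} → rank u ≤ rank v → level u ≤ level v)
  (later-degree : ∀ u → count (λ w → adj G u w ∧ (rank u <ᵇ rank w)) ≤ level u)
  where

  adj-symT : ∀ {u v} → T (adj G u v) → T (adj G v u)
  adj-symT {u} {v} = subst T (adj-sym G u v)

  adj⇒≢ : ∀ {u v} → T (adj G u v) → u ≢ v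
  adj⇒≢ {u} e refl = subst T (adj-irrefl G u) e

  -- `x` comes last among three vertices that carry a path: it is the middle vertex in the first
  -- alternative and an end in the second.
  CompletesPath : VSet n → Fin n → Fin n → Fin n → Set
  CompletesPath R x t₁ t₂ =
    t₁ ≢ t₂ × t₁ ∈ R × t₂ ∈ R × rank t₁ < rank x × rank t₂ < rank x ×
    T (adj G x t₁) × (T (adj G x t₂) ⊎ T (adj G t₁ t₂))

  Bad : VSet n → Fin n → Set
  Bad R x = x ∈ R × ∃₂ (CompletesPath R x)

  bad? : ∀ R → Decidable (Bad R)
  bad? R x = T? _ ×-dec any? λ t₁ → any? λ t₂ →
    ¬? (t₁ ≟ t₂) ×-dec T? _ ×-dec T? _ ×-dec (_ <? _) ×-dec (_ <? _) ×-dec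
    T? _ ×-dec (T? _ ⊎-dec T? _)

  -- The path s, u, t makes its last vertex bad, and since s precedes t this is t or u.
  fork⇒bad : (R : VSet n) → ∀ {u s t} → u ∈ R → s ∈ R → t ∈ R →
    T (adj G u s) → T (adj G u t) → rank s < rank t → Bad R t ⊎ Bad R u
  fork⇒bad R {u} {s} {t} u∈R s∈R t∈R us ut s<t with <-cmp (rank u) (rank t)
  ... | tri< u<t _ _ = inj₁ (t∈R , u , s , adj⇒≢ us , u∈R , s∈R , u<t , s<t , adj-symT ut , inj₂ us)
  ... | tri≈ _ eq _  = contradiction (rank-injective eq) (adj⇒≢ ut)
  ... | tri> _ _ t<u = inj₂ (u∈R , s , t ,
          <⇒≢ s<t ∘ cong rank , s∈R , t∈R , <-trans s<t t<u , t<u , us , inj₁ ut)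

  -- Two distinct neighbours of `u` would give a fork inside `A`, whose last vertex is bad.
  no-bad⇒matching : (R A : VSet n) → (∀ {v} → v ∈ A → v ∈ R) → (∀ {v} → v ∈ A → ¬ Bad R v) →
    ∀ {u s t} → u ∈ A → s ∈ A → t ∈ A → T (adj G u s) → T (adj G u t) → s ≡ t
  no-bad⇒matching R A A⊆R ¬bad {u} {s} {t} u∈A s∈A t∈A us ut with <-cmp (rank s) (rank t)
  ... | tri< s<t _ _ = ⊥-elim ([ ¬bad t∈A , ¬bad u∈A ]
          (fork⇒bad R (A⊆R u∈A) (A⊆R s∈A) (A⊆R t∈A) us ut s<t))
  ... | tri≈ _ eq _  = rank-injective eq
  ... | tri> _ _ t<s = ⊥-elim ([ ¬bad s∈A , ¬bad u∈A ]
          (fork⇒bad R (A⊆R u∈A) (A⊆R t∈A) (A⊆R s∈A) ut us t<s))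

  count-neighbours≤1 : (A : VSet n) →
    (∀ {u s t} → u ∈ A → s ∈ A → t ∈ A → T (adj G u s) → T (adj G u t) → s ≡ t) →
    ∀ u → u ∈ A → degInduced G A u ≤ 1
  count-neighbours≤1 A matching u u∈A = count-unique _ λ s t s∈ t∈ →
    matching u∈A (T∧ˡ (A s) s∈) (T∧ˡ (A t) t∈) (T∧ʳ (A s) s∈) (T∧ʳ (A t) t∈)

  -- `Q` joins the independent set and `U` is deleted; by `closed`, no edge runs from `Q` to what is
  -- left. `balance` is the inequality weight of `U` ≤ |`Q`| with denominators cleared, from the
  -- bounds (d + 1 - level)/(d + 1/3) on `Q` and 1/(d + 1/3) on the rest of `U`.
  record Reducible (R : VSet n) : Set where
    field
      Q U       : VSet n
      d         : ℕ
      Q⊆U       : ∀ {v} → v ∈ Q → v ∈ U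
      U⊆R       : ∀ {v} → v ∈ U → v ∈ R
      nonempty  : ∃ (_∈ U)
      closed    : ∀ {u v} → u ∈ Q → v ∈ R → T (adj G u v) → v ∈ U
      indep     : IsKIndependent 2 G Q
      level≤d   : ∀ {v} → v ∈ Q → level v ≤ d
      d≤level   : ∀ {v} → v ∈ (U ∖ Q) → d ≤ level v
      balance   : 2 * count Q + 3 * count (U ∖ Q) ≤ 3 * ∑[ v < n ] (⟦ Q v ⟧ * level v)

  -- The configuration at the first bad vertex

  module FirstBad
    (R : VSet n) {x t₁ t₂ : Fin n} (x∈R : x ∈ R) (bad : CompletesPath R x t₁ t₂)
    (first : ∀ v → Bad R v → rank x ≤ rank v)
    where

    -- Looking two steps away from `x` suffices to collect whole components, because the components
    -- of `A` have at most two vertices.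
    A X M : VSet n
    A v = R v ∧ (rank v <ᵇ rank x)
    X v = A v ∧ (adj G v x ∨ does (any? λ t → T? (A t ∧ (adj G v t ∧ adj G t x))))
    M v = X v ∨ x ≡ᶠ v

    ∈A⁺ : ∀ {v} → v ∈ R → rank v < rank x → v ∈ A
    ∈A⁺ v∈R v<x = T∧ v∈R (<⇒<ᵇ v<x)

    A⊆R : ∀ {v} → v ∈ A → v ∈ R
    A⊆R {v} = T∧ˡ (R v)

    A<x : ∀ {v} → v ∈ A → rank v < rank x
    A<x {v} v∈A = <ᵇ⇒< (rank v) (rank x) (T∧ʳ (R v) v∈A)

    -- A bad vertex in `A` would precede `x`, the first one.
    matching : ∀ {u s t} → u ∈ A → s ∈ A → t ∈ A → T (adj G u s) → T (adj G u t) → s ≡ t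
    matching = no-bad⇒matching R A A⊆R λ {v} v∈A v-bad → <⇒≱ (A<x v∈A) (first v v-bad)

    X⊆A : ∀ {v} → v ∈ X → v ∈ A
    X⊆A {v} = T∧ˡ (A v)

    X<x : ∀ {v} → v ∈ X → rank v < rank x
    X<x = A<x ∘ X⊆A

    X⁻ : ∀ {v} → v ∈ X → T (adj G v x) ⊎ ∃ λ t → t ∈ A × T (adj G v t) × T (adj G t x)
    X⁻ {v} v∈X with T∨⁻ (adj G v x) (T∧ʳ (A v) v∈X)
    ... | inj₁ vx = inj₁ vx
    ... | inj₂ p with T-does⁻ (any? _) p
    ...   | t , q = inj₂ (t , T∧ˡ (A t) q , T∧ˡ (adj G v t) (T∧ʳ (A t) q) , T∧ʳ (adj G v t) (T∧ʳ (A t) q))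

    X-adjacent : ∀ {v} → v ∈ A → T (adj G v x) → v ∈ X
    X-adjacent {v} v∈A vx = T∧ v∈A (T∨⁺ (adj G v x) (inj₁ vx))

    X-linked : ∀ {v t} → v ∈ A → t ∈ A → T (adj G v t) → T (adj G t x) → v ∈ X
    X-linked {v} {t} v∈A t∈A vt tx =
      T∧ v∈A (T∨⁺ (adj G v x) (inj₂ (T-does⁺ (any? _) (t , T∧ t∈A (T∧ vt tx)))))

    -- This makes `X` a union of components of `A`. If `u` reaches `x` only through `t`, then `t` is
    -- the sole neighbour of `u` in `A`, so `v` is `t`.
    X-closed : ∀ {u v} → u ∈ X → v ∈ A → T (adj G u v) → v ∈ X
    X-closed u∈X v∈A uv with X⁻ u∈X
    ... | inj₁ ux = X-linked v∈A (X⊆A u∈X) (adj-symT uv) ux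
    ... | inj₂ (t , t∈A , ut , tx) with refl ← matching (X⊆A u∈X) v∈A t∈A uv ut = X-adjacent v∈A tx

    completed-path⊆X : CompletesPath R x t₁ t₂ → t₁ ≢ t₂ × t₁ ∈ X × t₂ ∈ X
    completed-path⊆X (t₁≢t₂ , t₁∈R , t₂∈R , t₁<x , t₂<x , xt₁ , xt₂⊎t₁t₂) =
      t₁≢t₂ , X-adjacent t₁∈A (adj-symT xt₁) ,
      [ X-adjacent t₂∈A ∘ adj-symT , (λ t₁t₂ → X-linked t₂∈A t₁∈A (adj-symT t₁t₂) (adj-symT xt₁)) ] xt₂⊎t₁t₂
      where
      t₁∈A = ∈A⁺ t₁∈R t₁<x
      t₂∈A = ∈A⁺ t₂∈R t₂<x

    -- The two earlier vertices of the path completed by `x` both lie in `X`.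
    2≤|X| : 2 ≤ count X
    2≤|X| = let t₁≢t₂ , t₁∈X , t₂∈X = completed-path⊆X bad in distinct⇒2≤count X t₁≢t₂ t₁∈X t₂∈X

    lt : Fin n → Fin n → Bool
    lt u v = rank u <ᵇ rank v

    -- Each vertex of `p` contributes its edge to `x`, and each vertex of `q` an edge to some vertex
    -- of `p`; these edges are all different.
    p q : VSet n
    p u = X u ∧ adj G u x
    q u = X u ∧ not (adj G u x)

    p⊆X : ∀ {u} → u ∈ p → u ∈ X
    p⊆X {u} = T∧ˡ (X u)

    q⊆X : ∀ {u} → u ∈ q → u ∈ X
    q⊆X {u} = T∧ˡ (X u)

    q⇒¬p : ∀ {u} → u ∈ q → ¬ u ∈ p
    q⇒¬p {u} u∈q u∈p = T-not⁻ (T∧ʳ (X u) u∈q) (T∧ʳ (X u) u∈p)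

    -- The order test counts each edge within `X` once, at its earlier end, where `later-degree` can
    -- pay for it.
    inner : Fin n → Fin n → Bool
    inner u v = (X u ∧ X v) ∧ (adj G u v ∧ lt u v)

    -- X ∪ {x} is connected, hence it spans at least |X| edges.
    edges-of-X∪x : count X ≤ count p + ∑[ u < n ] ∑[ v < n ] ⟦ inner u v ⟧
    edges-of-X∪x = begin
      count X                        ≡⟨ count≡∑ X ⟩
      ∑[ u < n ] ⟦ X u ⟧             ≤⟨ ∑-mono-≤ (λ u → ⟦⟧-cover (X u) (p⊎q u)) ⟩
      ∑[ u < n ] (⟦ p u ⟧ + ⟦ q u ⟧) ≡⟨ ∑-distrib-+ (⟦_⟧ ∘ p) (⟦_⟧ ∘ q) ⟩
      ∑[ u < n ] ⟦ p u ⟧ + ∑[ u < n ] ⟦ q u ⟧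
        ≡⟨ cong (_+ sum (⟦_⟧ ∘ q)) (count≡∑ p) ⟨
      count p + ∑[ u < n ] ⟦ q u ⟧
        ≤⟨ +-monoʳ-≤ (count p) (∑-mono-≤ q≤) ⟩
      count p + ∑[ u < n ] ∑[ v < n ] (⟦ f u v ∧ lt u v ⟧ + ⟦ f u v ∧ lt v u ⟧)
        ≡⟨ cong (count p +_) regroup ⟩
      count p + ∑[ u < n ] ∑[ v < n ] (⟦ f u v ∧ lt u v ⟧ + ⟦ f v u ∧ lt u v ⟧)
        ≤⟨ +-monoʳ-≤ (count p) (∑-mono-≤ λ u → ∑-mono-≤ λ v → f≤inner u v) ⟩
      count p + ∑[ u < n ] ∑[ v < n ] ⟦ inner u v ⟧ ∎
      where
      open ≤-Reasoning

      -- Edges between `q` and `p`, written with the end in `q` first whatever the ranks.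
      f : Fin n → Fin n → Bool
      f u v = (q u ∧ p v) ∧ adj G u v

      p⊎q : ∀ u → u ∈ X → u ∈ p ⊎ u ∈ q
      p⊎q u u∈X with T? (adj G u x)
      ... | yes ux = inj₁ (T∧ u∈X ux)
      ... | no ¬ux = inj₂ (T∧ u∈X (T-not⁺ ¬ux))

      fq : ∀ u v → T (f u v) → u ∈ q
      fq u v e = T∧ˡ (q u) (T∧ˡ (q u ∧ p v) e)

      fp : ∀ u v → T (f u v) → v ∈ p
      fp u v e = T∧ʳ (q u) (T∧ˡ (q u ∧ p v) e)

      fa : ∀ u v → T (f u v) → T (adj G u v)
      fa u v e = T∧ʳ (q u ∧ p v) e

      split-order : ∀ u v → ⟦ f u v ⟧ ≤ ⟦ f u v ∧ lt u v ⟧ + ⟦ f u v ∧ lt v u ⟧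
      split-order u v = ⟦⟧-cover (f u v) λ e → compare e
        where
        compare : T (f u v) → T (f u v ∧ lt u v) ⊎ T (f u v ∧ lt v u)
        compare e with <-cmp (rank u) (rank v)
        ... | tri< u<v _ _ = inj₁ (T∧ e (<⇒<ᵇ u<v))
        ... | tri≈ _ eq _  = contradiction (rank-injective eq) (adj⇒≢ (fa u v e))
        ... | tri> _ _ v<u = inj₂ (T∧ e (<⇒<ᵇ v<u))

      q-partner : ∀ u → u ∈ q → ∃ λ v → T (f u v)
      q-partner u u∈q with X⁻ (q⊆X u∈q)
      ... | inj₁ ux = contradiction (T∧ (q⊆X u∈q) ux) (q⇒¬p u∈q)
      ... | inj₂ (t , t∈A , ut , tx) = t , T∧ {q u ∧ p t} (T∧ u∈q (T∧ (X-adjacent t∈A tx) tx)) ut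

      q≤ : ∀ u → ⟦ q u ⟧ ≤ ∑[ v < n ] (⟦ f u v ∧ lt u v ⟧ + ⟦ f u v ∧ lt v u ⟧)
      q≤ u with T? (q u)
      ... | no ¬u∈q  = ≤-trans (⟦⟧-mono {c = false} ¬u∈q) z≤n
      ... | yes u∈q with q-partner u u∈q
      ...   | v , e = begin
        ⟦ q u ⟧                   ≤⟨ ⟦⟧-mono (λ _ → e) ⟩
        ⟦ f u v ⟧                 ≤⟨ term≤∑ (λ v → ⟦ f u v ⟧) v ⟩
        ∑[ v < n ] ⟦ f u v ⟧      ≤⟨ ∑-mono-≤ (split-order u) ⟩
        ∑[ v < n ] (⟦ f u v ∧ lt u v ⟧ + ⟦ f u v ∧ lt v u ⟧) ∎

      -- Exchanging the summation variables in the second sum puts the earlier end first in both.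
      regroup : ∑[ u < n ] ∑[ v < n ] (⟦ f u v ∧ lt u v ⟧ + ⟦ f u v ∧ lt v u ⟧)
              ≡ ∑[ u < n ] ∑[ v < n ] (⟦ f u v ∧ lt u v ⟧ + ⟦ f v u ∧ lt u v ⟧)
      regroup =
        trans (∑∑-distrib-+ (λ u v → ⟦ f u v ∧ lt u v ⟧) (λ u v → ⟦ f u v ∧ lt v u ⟧))
        (trans (cong (∑[ u < n ] ∑[ v < n ] ⟦ f u v ∧ lt u v ⟧ +_) (∑-comm (λ u v → ⟦ f u v ∧ lt v u ⟧)))
        (sym (∑∑-distrib-+ (λ u v → ⟦ f u v ∧ lt u v ⟧) (λ u v → ⟦ f v u ∧ lt u v ⟧))))

      -- The two terms exclude each other, since `u` would lie in `q` for the first and in `p` for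
      -- the second.
      f≤inner : ∀ u v → ⟦ f u v ∧ lt u v ⟧ + ⟦ f v u ∧ lt u v ⟧ ≤ ⟦ inner u v ⟧
      f≤inner u v = ⟦⟧-disjoint (f u v ∧ lt u v) (f v u ∧ lt u v)
        (λ e → let e′ = T∧ˡ (f u v) e in
          T∧ {X u ∧ X v} (T∧ (q⊆X (fq u v e′)) (p⊆X (fp u v e′))) (T∧ (fa u v e′) (T∧ʳ (f u v) e)))
        (λ e → let e′ = T∧ˡ (f v u) e in
          T∧ {X u ∧ X v} (T∧ (p⊆X (fp v u e′)) (q⊆X (fq v u e′))) (T∧ (adj-symT (fa v u e′)) (T∧ʳ (f v u) e)))
        (λ e e′ → q⇒¬p (fq u v (T∧ˡ (f u v) e)) (fp v u (T∧ˡ (f v u) e′)))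

    -- Treats `Q` = `X` and `Q` = `M` together. Either way `x` is deleted, being in `M`.
    module Choice (Q : VSet n) (X⊆Q : ∀ {v} → v ∈ X → v ∈ Q) (Q⊆M : ∀ {v} → v ∈ Q → v ∈ M) where

      Y U : VSet n
      Y v = (R v ∧ not (M v)) ∧ does (any? λ s → T? (Q s ∧ adj G s v))
      U v = M v ∨ Y v

      Y⁻ : ∀ {v} → v ∈ Y → v ∈ R × ¬ v ∈ M × ∃ λ s → s ∈ Q × T (adj G s v)
      Y⁻ {v} v∈Y with T-does⁻ (any? _) (T∧ʳ (R v ∧ not (M v)) v∈Y)
      ... | s , e = T∧ˡ (R v) v∈R∖M , T-not⁻ (T∧ʳ (R v) v∈R∖M) , s , T∧ˡ (Q s) e , T∧ʳ (Q s) e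
        where v∈R∖M = T∧ˡ (R v ∧ not (M v)) v∈Y

      M⁻ : ∀ {v} → v ∈ M → v ∈ X ⊎ x ≡ v
      M⁻ {v} v∈M = [ inj₁ , inj₂ ∘ T-does⁻ (x ≟ v) ] (T∨⁻ (X v) v∈M)

      X⊆M : ∀ {v} → v ∈ X → v ∈ M
      X⊆M {v} v∈X = T∨⁺ (X v) (inj₁ v∈X)

      x∈M : x ∈ M
      x∈M = T∨⁺ (X x) (inj₂ (T-does⁺ (x ≟ x) refl))

      M⊆R : ∀ {v} → v ∈ M → v ∈ R
      M⊆R v∈M with M⁻ v∈M
      ... | inj₁ v∈X  = A⊆R (X⊆A v∈X)
      ... | inj₂ refl = x∈R

      M-closed : ∀ {u v} → u ∈ M → v ∈ A → T (adj G u v) → v ∈ M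
      M-closed u∈M v∈A uv with M⁻ u∈M
      ... | inj₁ u∈X  = X⊆M (X-closed u∈X v∈A uv)
      ... | inj₂ refl = X⊆M (X-adjacent v∈A (adj-symT uv))

      M≤x : ∀ {v} → v ∈ M → rank v ≤ rank x
      M≤x v∈M with M⁻ v∈M
      ... | inj₁ v∈X  = <⇒≤ (X<x v∈X)
      ... | inj₂ refl = ≤-refl

      -- A neighbour of `Q` in `R` that precedes `x` lies in `A`, hence in `M` by `M-closed`,
      -- whereas `Y` avoids `M`.
      Y>x : ∀ {v} → v ∈ Y → rank x < rank v
      Y>x {v} v∈Y with Y⁻ v∈Y | <-cmp (rank x) (rank v)
      ... | v∈R , v∉M , s , s∈Q , sv | tri< x<v _ _ = x<v
      ... | v∈R , v∉M , s , s∈Q , sv | tri≈ _ eq _  = contradiction (subst (_∈ M) (rank-injective eq) x∈M) v∉M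
      ... | v∈R , v∉M , s , s∈Q , sv | tri> _ _ v<x = contradiction (M-closed (Q⊆M s∈Q) (∈A⁺ v∈R v<x) sv) v∉M

      forward : Fin n → Fin n → Bool
      forward s v = Q s ∧ (adj G s v ∧ lt s v)

      ∑-forward≤ : ∀ s → ∑[ v < n ] ⟦ forward s v ⟧ ≤ ⟦ Q s ⟧ * level s
      ∑-forward≤ s with Q s
      ... | true  = ≤-trans (≤-reflexive (sym (count≡∑ (λ v → adj G s v ∧ lt s v)))) (≤-trans (later-degree s) (m≤m+n (level s) 0))
      ... | false = ≤-reflexive (∑-zero {n})

      -- In `to-x` the head is pinned to `x`, so the double sum counts each vertex of `p` once.
      to-x to-Y : Fin n → Fin n → Bool
      to-x s v = x ≡ᶠ v ∧ p s
      to-Y s v = Y v ∧ forward s v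

      -- The three kinds of edges have their later ends in the disjoint sets `Y`, {`x`} and `X`, and
      -- their earlier ends in `Q`.
      forward-split : ∀ s v → ⟦ to-Y s v ⟧ + (⟦ to-x s v ⟧ + ⟦ inner s v ⟧) ≤ ⟦ forward s v ⟧
      forward-split s v with T? (Y v)
      ... | yes v∈Y = ≤-trans (+-monoʳ-≤ ⟦ to-Y s v ⟧ (+-mono-≤ (⟦⟧-mono {c = false} ¬to-x) (⟦⟧-mono {c = false} ¬inner)))
                              (≤-trans (≤-reflexive (+-identityʳ _)) (⟦⟧-mono (T∧ʳ (Y v))))
        where
        v∉M = proj₁ (proj₂ (Y⁻ v∈Y))
        ¬to-x : ¬ T (to-x s v)
        ¬to-x e = v∉M (T∨⁺ (X v) (inj₂ (T∧ˡ (x ≡ᶠ v) e)))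
        ¬inner : ¬ T (inner s v)
        ¬inner e = v∉M (X⊆M (T∧ʳ (X s) (T∧ˡ (X s ∧ X v) e)))
      ... | no v∉Y = +-mono-≤ (⟦⟧-mono {c = false} (v∉Y ∘ T∧ˡ (Y v))) (⟦⟧-disjoint (to-x s v) (inner s v)
        (λ e → to-x⇒forward (T-does⁻ (x ≟ v) (T∧ˡ (x ≡ᶠ v) e)) (T∧ʳ (x ≡ᶠ v) e))
        (λ e → T∧ (X⊆Q (T∧ˡ (X s) (T∧ˡ (X s ∧ X v) e))) (T∧ʳ (X s ∧ X v) e))
        (λ e e′ → <⇒≢ (X<x (T∧ʳ (X s) (T∧ˡ (X s ∧ X v) e′))) (cong rank (sym (T-does⁻ (x ≟ v) (T∧ˡ (x ≡ᶠ v) e))))))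
        where
        to-x⇒forward : ∀ {v} → x ≡ v → s ∈ p → T (forward s v)
        to-x⇒forward refl s∈p = T∧ (X⊆Q (p⊆X s∈p)) (T∧ (T∧ʳ (X s) s∈p) (<⇒<ᵇ (X<x (p⊆X s∈p))))

      -- A neighbour in `Q` is no later than `x`, and `v` is later than `x`, so the edge points
      -- forward.
      Y≤ : ∀ v → ⟦ Y v ⟧ ≤ ∑[ s < n ] ⟦ to-Y s v ⟧
      Y≤ v with T? (Y v)
      ... | no v∉Y  = ≤-trans (⟦⟧-mono {c = false} v∉Y) z≤n
      ... | yes v∈Y with Y⁻ v∈Y
      ...   | _ , _ , s , s∈Q , sv = ≤-trans
        (⟦⟧-mono (λ _ → T∧ v∈Y (T∧ s∈Q (T∧ sv (<⇒<ᵇ (≤-<-trans (M≤x (Q⊆M s∈Q)) (Y>x v∈Y)))))))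
        (term≤∑ (λ s → ⟦ to-Y s v ⟧) s)

      -- The levels on `Q` bound the number of edges from `Q` to later vertices. At least |`Y`| of
      -- these end in `Y`, and at least |`X`| lie within `X` ∪ {`x`}, each with its earlier end in
      -- `X`.
      level-total : count Y + count X ≤ ∑[ s < n ] (⟦ Q s ⟧ * level s)
      level-total = begin
        count Y + count X
          ≤⟨ +-mono-≤ |Y|≤ (≤-trans edges-of-X∪x (+-monoˡ-≤ _ |p|≤)) ⟩
        ∑∑ to-Y + (∑∑ to-x + ∑∑ inner)
          ≡⟨ cong (∑∑ to-Y +_) (∑∑-distrib-+ (λ s v → ⟦ to-x s v ⟧) (λ s v → ⟦ inner s v ⟧)) ⟨
        ∑∑ to-Y + ∑[ s < n ] ∑[ v < n ] (⟦ to-x s v ⟧ + ⟦ inner s v ⟧)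
          ≡⟨ ∑∑-distrib-+ (λ s v → ⟦ to-Y s v ⟧) (λ s v → ⟦ to-x s v ⟧ + ⟦ inner s v ⟧) ⟨
        ∑[ s < n ] ∑[ v < n ] (⟦ to-Y s v ⟧ + (⟦ to-x s v ⟧ + ⟦ inner s v ⟧))
          ≤⟨ ∑-mono-≤ (λ s → ≤-trans (∑-mono-≤ (forward-split s)) (∑-forward≤ s)) ⟩
        ∑[ s < n ] (⟦ Q s ⟧ * level s) ∎
        where
        open ≤-Reasoning
        ∑∑ : (Fin n → Fin n → Bool) → ℕ
        ∑∑ g = ∑[ s < n ] ∑[ v < n ] ⟦ g s v ⟧

        |Y|≤ : count Y ≤ ∑∑ to-Y
        |Y|≤ = ≤-trans (≤-reflexive (count≡∑ Y)) (≤-trans (∑-mono-≤ Y≤)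
                 (≤-reflexive (sym (∑-comm (λ s v → ⟦ to-Y s v ⟧)))))

        |p|≤ : count p ≤ ∑∑ to-x
        |p|≤ = ≤-trans (≤-reflexive (count≡∑ p)) (∑-mono-≤ λ s → ≤-trans
          (⟦⟧-mono (T∧ {x ≡ᶠ x} (T-does⁺ (x ≟ x) refl)))
          (term≤∑ (λ v → ⟦ to-x s v ⟧) x))

      reducible : IsKIndependent 2 G Q →
        2 * count Q + 3 * count (U ∖ Q) ≤ 3 * (count Y + count X) → Reducible R
      reducible indep balance = record
        { Q        = Q
        ; U        = U
        -- `Q` has no vertex after `x`, and `U` without `Q` has none before it, so this level
        -- separates the two.
        ; d        = level x
        ; Q⊆U      = λ {v} v∈Q → T∨⁺ (M v) (inj₁ (Q⊆M v∈Q))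
        ; U⊆R      = λ {v} v∈U → [ M⊆R , proj₁ ∘ Y⁻ ] (T∨⁻ (M v) v∈U)
        ; nonempty = x , T∨⁺ (M x) (inj₁ x∈M)
        ; closed   = closed
        ; indep    = indep
        ; level≤d  = λ v∈Q → level-mono (M≤x (Q⊆M v∈Q))
        ; d≤level  = d≤level
        ; balance  = ≤-trans balance (*-monoʳ-≤ 3 level-total)
        }
        where
        closed : ∀ {u v} → u ∈ Q → v ∈ R → T (adj G u v) → v ∈ U
        closed {u} {v} u∈Q v∈R uv with T? (M v)
        ... | yes v∈M = T∨⁺ (M v) (inj₁ v∈M)
        ... | no v∉M  = T∨⁺ (M v) (inj₂ (T∧ {R v ∧ not (M v)} (T∧ v∈R (T-not⁺ v∉M))
                          (T-does⁺ (any? _) (u , T∧ u∈Q uv))))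

        d≤level : ∀ {v} → v ∈ (U ∖ Q) → level x ≤ level v
        d≤level {v} v∈U∖Q with T∨⁻ (M v) (T∧ˡ (U v) v∈U∖Q)
        ... | inj₂ v∈Y = level-mono (<⇒≤ (Y>x v∈Y))
        ... | inj₁ v∈M with M⁻ v∈M
        ...   | inj₁ v∈X  = contradiction (X⊆Q v∈X) (T-not⁻ (T∧ʳ (U v) v∈U∖Q))
        ...   | inj₂ refl = ≤-refl

    reducible : Reducible R
    reducible with 3 ≤? count X
    -- Here `x` is deleted without being chosen. This costs 3 in `balance`, and the surplus |`X`|
    -- covers it.
    ... | yes 3≤|X| = C.reducible
        (λ u u∈X → ≤-trans (X-indep u u∈X) (s≤s z≤n)) balance
      where
      module C = Choice X (λ v∈X → v∈X) (λ {v} v∈X → T∨⁺ (X v) (inj₁ v∈X))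
      X-indep : ∀ u → u ∈ X → degInduced G X u ≤ 1
      X-indep = count-neighbours≤1 X λ u∈X s∈X t∈X → matching (X⊆A u∈X) (X⊆A s∈X) (X⊆A t∈X)

      |U∖X|≤ : count (C.U ∖ X) ≤ suc (count C.Y)
      |U∖X|≤ = begin
        count (C.U ∖ X)                       ≡⟨ count≡∑ (C.U ∖ X) ⟩
        ∑[ v < n ] ⟦ (C.U ∖ X) v ⟧            ≤⟨ ∑-mono-≤ (λ v → ⟦⟧-cover _ (cover v)) ⟩
        ∑[ v < n ] (⟦ x ≡ᶠ v ⟧ + ⟦ C.Y v ⟧)   ≡⟨ ∑-distrib-+ (⟦_⟧ ∘ (x ≡ᶠ_)) (⟦_⟧ ∘ C.Y) ⟩
        ∑[ v < n ] ⟦ x ≡ᶠ v ⟧ + sum (⟦_⟧ ∘ C.Y) ≡⟨ cong₂ _+_ (∑-δ x) (sym (count≡∑ C.Y)) ⟩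
        suc (count C.Y)                       ∎
        where
        open ≤-Reasoning
        cover : ∀ v → v ∈ (C.U ∖ X) → v ∈ (x ≡ᶠ_) ⊎ v ∈ C.Y
        cover v v∈ with T∨⁻ (M v) (T∧ˡ (C.U v) v∈)
        ... | inj₂ v∈Y = inj₂ v∈Y
        ... | inj₁ v∈M with T∨⁻ (X v) v∈M
        ...   | inj₁ v∈X = contradiction v∈X (T-not⁻ (T∧ʳ (C.U v) v∈))
        ...   | inj₂ v≡x = inj₁ v≡x

      balance : 2 * count X + 3 * count (C.U ∖ X) ≤ 3 * (count C.Y + count X)
      balance = begin
        2 * count X + 3 * count (C.U ∖ X)  ≤⟨ +-monoʳ-≤ (2 * count X) (*-monoʳ-≤ 3 |U∖X|≤) ⟩
        2 * count X + 3 * suc (count C.Y)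
          ≡⟨ solve 2 (λ a y → con 2 :* a :+ con 3 :* (con 1 :+ y) := con 3 :* y :+ con 2 :* a :+ con 3)
                   refl (count X) (count C.Y) ⟩
        3 * count C.Y + 2 * count X + 3    ≤⟨ +-monoʳ-≤ (3 * count C.Y + 2 * count X) 3≤|X| ⟩
        3 * count C.Y + 2 * count X + count X
          ≡⟨ solve 2 (λ a y → con 3 :* y :+ con 2 :* a :+ a := con 3 :* (y :+ a)) refl (count X) (count C.Y) ⟩
        3 * (count C.Y + count X)          ∎
        where open ≤-Reasoning
    -- Now |`X`| = 2 and `M` has three vertices: 2 · 3 on the left of `balance` meets 3 · 2 on the
    -- right.
    ... | no 3≰|X| = C.reducible M-indep balance
      where
      module C = Choice M (λ {v} v∈X → T∨⁺ (X v) (inj₁ v∈X)) (λ v∈M → v∈M)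

      |M|≤3 : count M ≤ 3
      |M|≤3 = begin
        count M                    ≡⟨ count-remove M C.x∈M ⟨
        suc (count (M ∖ (x ≡ᶠ_)))  ≤⟨ s≤s (count-mono M∖x⊆X) ⟩
        suc (count X)              ≤⟨ ≰⇒> 3≰|X| ⟩
        3                          ∎
        where
        open ≤-Reasoning
        M∖x⊆X : ∀ v → v ∈ (M ∖ (x ≡ᶠ_)) → v ∈ X
        M∖x⊆X v v∈ with T∨⁻ (X v) (T∧ˡ (M v) v∈)
        ... | inj₁ v∈X = v∈X
        ... | inj₂ v≡x = contradiction v≡x (T-not⁻ (T∧ʳ (M v) v∈))

      -- Among three vertices, each has at most two others as neighbours.
      M-indep : IsKIndependent 2 G M
      M-indep u u∈M = ≤-pred (begin
        suc (degInduced G M u)     ≤⟨ s≤s (count-mono λ w w∈ → T∧ (T∧ˡ (M w) w∈)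
                                        (T-not⁺ (adj⇒≢ (T∧ʳ (M w) w∈) ∘ T-does⁻ (u ≟ w)))) ⟩
        suc (count (M ∖ (u ≡ᶠ_)))  ≡⟨ count-remove M u∈M ⟩
        count M                    ≤⟨ |M|≤3 ⟩
        3                          ∎)
        where open ≤-Reasoning

      U∖M⊆Y : ∀ v → v ∈ (C.U ∖ M) → v ∈ C.Y
      U∖M⊆Y v v∈ with T∨⁻ (M v) (T∧ˡ (C.U v) v∈)
      ... | inj₁ v∈M = contradiction v∈M (T-not⁻ (T∧ʳ (C.U v) v∈))
      ... | inj₂ v∈Y = v∈Y

      balance : 2 * count M + 3 * count (C.U ∖ M) ≤ 3 * (count C.Y + count X)
      balance = begin
        2 * count M + 3 * count (C.U ∖ M)
          ≤⟨ +-mono-≤ (*-monoʳ-≤ 2 |M|≤3) (*-monoʳ-≤ 3 (count-mono U∖M⊆Y)) ⟩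
        3 * 2 + 3 * count C.Y      ≡⟨ +-comm (3 * 2) (3 * count C.Y) ⟩
        3 * count C.Y + 3 * 2      ≤⟨ +-monoʳ-≤ (3 * count C.Y) (*-monoʳ-≤ 3 2≤|X|) ⟩
        3 * count C.Y + 3 * count X ≡⟨ *-distribˡ-+ 3 (count C.Y) (count X) ⟨
        3 * (count C.Y + count X)  ∎
        where open ≤-Reasoning

-- Rational weights

open import Data.Integer using (+_)

-- The operation `_/_` reduces to lowest terms, so cross-multiplication is carried out on
-- unnormalised fractions.
/-mono-≤ : ∀ a p b q → a * suc q ≤ b * suc p → (+ a) / suc p ℚ.≤ (+ b) / suc q
/-mono-≤ a p b q le = ℚ.toℚᵘ-cancel-≤ (begin
  toℚᵘ ((+ a) / suc p)  ≃⟨ ℚ.toℚᵘ-fromℚᵘ (mkℚᵘ (+ a) p) ⟩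
  mkℚᵘ (+ a) p          ≤⟨ *≤* (subst₂ ℤ._≤_ (ℤ.pos-* a (suc q)) (ℤ.pos-* b (suc p)) (ℤ.+≤+ le)) ⟩
  mkℚᵘ (+ b) q          ≃⟨ ℚ.toℚᵘ-fromℚᵘ (mkℚᵘ (+ b) q) ⟨
  toℚᵘ ((+ b) / suc q)  ∎)
  where open ℚᵘ.≤-Reasoning

/-+-/ : ∀ a b q → (+ a) / suc q ℚ.+ (+ b) / suc q ≡ (+ (a + b)) / suc q
/-+-/ a b q = ℚ.toℚᵘ-injective (begin-equality
  toℚᵘ ((+ a) / suc q ℚ.+ (+ b) / suc q)          ≃⟨ ℚ.toℚᵘ-homo-+ ((+ a) / suc q) ((+ b) / suc q) ⟩
  toℚᵘ ((+ a) / suc q) ℚᵘ.+ toℚᵘ ((+ b) / suc q)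
    ≃⟨ ℚᵘ.+-cong (ℚ.toℚᵘ-fromℚᵘ (mkℚᵘ (+ a) q)) (ℚ.toℚᵘ-fromℚᵘ (mkℚᵘ (+ b) q)) ⟩
  mkℚᵘ (+ a) q ℚᵘ.+ mkℚᵘ (+ b) q                  ≃⟨ *≡* cross ⟩
  mkℚᵘ (+ (a + b)) q                              ≃⟨ ℚ.toℚᵘ-fromℚᵘ (mkℚᵘ (+ (a + b)) q) ⟨
  toℚᵘ ((+ (a + b)) / suc q)                      ∎)
  where
  open ℚᵘ.≤-Reasoning
  Q = suc q
  cross : ((+ a) ℤ.* (+ Q) ℤ.+ (+ b) ℤ.* (+ Q)) ℤ.* (+ Q) ≡ (+ (a + b)) ℤ.* (+ (Q * Q))
  cross rewrite sym (ℤ.pos-* a Q) | sym (ℤ.pos-* b Q) | sym (ℤ.pos-* (a * Q + b * Q) Q)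
              | sym (ℤ.pos-* (a + b) (Q * Q)) =
    cong (+_) (solve 3 (λ a b q → (a :* q :+ b :* q) :* q := (a :+ b) :* (q :* q)) refl a b Q)

sumℚ-mono-≤ : {f g : Fin n → ℚ} → (∀ i → f i ℚ.≤ g i) → sumℚ f ℚ.≤ sumℚ g
sumℚ-mono-≤ {zero}  f≤g = ℚ.≤-refl
sumℚ-mono-≤ {suc n} f≤g = ℚ.+-mono-≤ (f≤g zero) (sumℚ-mono-≤ (f≤g ∘ suc))

sumℚ-/ : ∀ (k : Fin n → ℕ) q → sumℚ (λ i → (+ k i) / suc q) ℚ.≤ (+ sum k) / suc q
sumℚ-/ {zero}  k q = /-mono-≤ 0 0 0 q z≤n
sumℚ-/ {suc n} k q = ℚ.≤-trans (ℚ.+-monoʳ-≤ ((+ k zero) / suc q) (sumℚ-/ (k ∘ suc) q))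
                               (ℚ.≤-reflexive (/-+-/ (k zero) (sum (k ∘ suc)) q))

foldr-map-tabulate : ∀ {m} (f : Fin n → ℚ) (g : Fin m → Fin n) →
  foldr ℚ._+_ 0ℚ (map f (tabulate g)) ≡ sumℚ (f ∘ g)
foldr-map-tabulate {m = zero}  f g = refl
foldr-map-tabulate {m = suc m} f g = cong (f (g zero) ℚ.+_) (foldr-map-tabulate f (g ∘ suc))

Z3term≤1 : ∀ z → Z3term z ℚ.≤ 1ℚ
Z3term≤1 z = ℚ.p⊓q≤p 1ℚ ((+ 3) / suc (3 * z))

Z3term≤3/ : ∀ {d z} → d ≤ z → Z3term z ℚ.≤ (+ 3) / suc (3 * d)
Z3term≤3/ {d} {z} d≤z = ℚ.≤-trans (ℚ.p⊓q≤q 1ℚ ((+ 3) / suc (3 * z)))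
  (/-mono-≤ 3 (3 * z) 3 (3 * d) (*-monoʳ-≤ 3 (s≤s (*-monoʳ-≤ 3 d≤z))))

Z3term-antitone : ∀ {y z} → y ≤ z → Z3term z ℚ.≤ Z3term y
Z3term-antitone {y} {z} y≤z = ℚ.⊓-glb {Z3term z} {1ℚ} {(+ 3) / suc (3 * y)} (Z3term≤1 z) (Z3term≤3/ y≤z)

-- In units of 1/(d + 1/3), a vertex of level z ≤ d weighs at most d + 1 − z.
Z3term≤deficit : ∀ {d z} → z ≤ d → Z3term z ℚ.≤ (+ (3 * (suc d ∸ z))) / suc (3 * d)
-- At level 0 the cap 1 is the bound that works: 3(d + 1) exceeds 3d + 1 by 2.
Z3term≤deficit {d} {zero} _ = ℚ.≤-trans (Z3term≤1 0) (/-mono-≤ 1 0 (3 * suc d) (3 * d) (begin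
  1 * suc (3 * d)        ≤⟨ m≤n+m (1 * suc (3 * d)) 2 ⟩
  2 + 1 * suc (3 * d)    ≡⟨ solve 1 (λ d → con 2 :+ con 1 :* (con 1 :+ con 3 :* d) := con 3 :* (con 1 :+ d) :* con 1) refl d ⟩
  3 * suc d * 1          ∎))
  where open ≤-Reasoning
-- With z = c + 1 and t = d - z, the two cross-products differ by 3t(3z - 2) = 3(3ct + t),
-- nonnegative because z ≥ 1.
Z3term≤deficit {d} {suc c} z≤d = ℚ.≤-trans (ℚ.p⊓q≤q 1ℚ ((+ 3) / suc (3 * suc c)))
  (/-mono-≤ 3 (3 * suc c) (3 * (suc d ∸ suc c)) (3 * d) (begin
    3 * suc (3 * d)              ≡⟨ cong (λ d → 3 * suc (3 * d)) (m+[n∸m]≡n z≤d) ⟨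
    3 * suc (3 * (suc c + t))    ≤⟨ m≤m+n (3 * suc (3 * (suc c + t))) (3 * (3 * c * t + t)) ⟩
    3 * suc (3 * (suc c + t)) + 3 * (3 * c * t + t)
      ≡⟨ solve 2 (λ c t → con 3 :* (con 1 :+ con 3 :* (con 1 :+ c :+ t)) :+ con 3 :* (con 3 :* c :* t :+ t)
                       := con 3 :* (con 1 :+ t) :* (con 1 :+ con 3 :* (con 1 :+ c))) refl c t ⟩
    3 * suc t * suc (3 * suc c)  ≡⟨ cong (λ t → 3 * t * suc (3 * suc c)) (+-∸-assoc 1 z≤d) ⟨
    3 * (suc d ∸ suc c) * suc (3 * suc c) ∎))
  where
  open ≤-Reasoning
  t = d ∸ suc c

weight : VSet n → (Fin n → ℚ) → ℚ
weight R w = sumℚ (λ v → if R v then w v else 0ℚ)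

weight-∖ : {R U : VSet n} (w : Fin n → ℚ) → (∀ {v} → v ∈ U → v ∈ R) →
  weight R w ≡ weight U w ℚ.+ weight (R ∖ U) w
weight-∖ {R = R} {U} w U⊆R = trans (sumℚ-cong-≗ pointwise) (∑ℚ-distrib-+ (λ v → if U v then w v else 0ℚ) _)
  where
  pointwise : ∀ v → (if R v then w v else 0ℚ) ≡
    (if U v then w v else 0ℚ) ℚ.+ (if (R ∖ U) v then w v else 0ℚ)
  pointwise v with R v | U v | U⊆R {v}
  ... | true  | true  | _ = sym (ℚ.+-identityʳ (w v))
  ... | true  | false | _ = sym (ℚ.+-identityˡ (w v))
  ... | false | true  | h = ⊥-elim (h _)
  ... | false | false | _ = refl

-- Induction over vertex subsets

module Induction
  (G : Graph n) (rank level : Fin n → ℕ)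
  (rank-injective : ∀ {u v} → rank u ≡ rank v → u ≡ v)
  (level-mono : ∀ {u v} → rank u ≤ rank v → level u ≤ level v)
  (later-degree : ∀ u → count (λ w → adj G u w ∧ (rank u <ᵇ rank w)) ≤ level u)
  where

  open Reduction G rank level rank-injective level-mono later-degree

  w : Fin n → ℚ
  w v = Z3term (level v)

  weight≤count : ∀ R → weight R w ℚ.≤ (+ count R) / 1
  weight≤count R = ℚ.≤-trans (sumℚ-mono-≤ pointwise)
    (ℚ.≤-trans (sumℚ-/ (⟦_⟧ ∘ R) 0) (ℚ.≤-reflexive (cong (λ k → (+ k) / 1) (sym (count≡∑ R)))))
    where
    pointwise : ∀ v → (if R v then w v else 0ℚ) ℚ.≤ (+ ⟦ R v ⟧) / 1
    pointwise v with R v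
    ... | true  = Z3term≤1 (level v)
    ... | false = ℚ.≤-refl

  weight-reducible : ∀ {R} (red : Reducible R) →
    weight (Reducible.U red) w ℚ.≤ (+ count (Reducible.Q red)) / 1
  weight-reducible red = ℚ.≤-trans (sumℚ-mono-≤ pointwise)
    (ℚ.≤-trans (sumℚ-/ k (3 * d)) (/-mono-≤ (sum k) (3 * d) (count Q) 0 ∑k≤))
    where
    open Reducible red

    -- Numerators over the common denominator 3d + 1, so that the weight of `U` becomes an integer
    -- sum.
    k : Fin n → ℕ
    k v = if Q v then 3 * (suc d ∸ level v) else if U v then 3 else 0

    pointwise : ∀ v → (if U v then w v else 0ℚ) ℚ.≤ (+ k v) / suc (3 * d)
    pointwise v with Q v | U v | Q⊆U {v} | level≤d {v} | d≤level {v}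
    ... | true  | true  | _ | l≤d | _   = Z3term≤deficit (l≤d _)
    ... | true  | false | h | _   | _   = ⊥-elim (h _)
    ... | false | true  | _ | _   | d≤l = Z3term≤3/ (d≤l _)
    ... | false | false | _ | _   | _   = /-mono-≤ 0 0 0 (3 * d) z≤n

    -- Adding the levels back removes the truncated subtraction, which is exact because levels on
    -- `Q` are at most `d`.
    k-level : ∀ v → k v + 3 * (⟦ Q v ⟧ * level v) ≡ 3 * suc d * ⟦ Q v ⟧ + 3 * ⟦ (U ∖ Q) v ⟧
    k-level v with Q v | U v | Q⊆U {v} | level≤d {v}
    ... | true  | false | h | _   = ⊥-elim (h _)
    ... | false | true  | _ | _   = sym (cong (_+ 3) (*-zeroʳ (3 * suc d)))
    ... | false | false | _ | _   = sym (cong (_+ 0) (*-zeroʳ (3 * suc d)))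
    ... | true  | true  | _ | l≤d = begin
      3 * (suc d ∸ level v) + 3 * (1 * level v) ≡⟨ *-distribˡ-+ 3 (suc d ∸ level v) (1 * level v) ⟨
      3 * (suc d ∸ level v + 1 * level v)       ≡⟨ cong (λ l → 3 * (suc d ∸ level v + l)) (*-identityˡ (level v)) ⟩
      3 * (suc d ∸ level v + level v)           ≡⟨ cong (3 *_) (m∸n+n≡m (m≤n⇒m≤1+n (l≤d _))) ⟩
      3 * suc d                                 ≡⟨ *-identityʳ (3 * suc d) ⟨
      3 * suc d * 1                             ≡⟨ +-identityʳ (3 * suc d * 1) ⟨
      3 * suc d * 1 + 0                         ∎
      where open ≡-Reasoning

    L : ℕ
    L = ∑[ v < n ] (⟦ Q v ⟧ * level v)

    ∑k-level : sum k + 3 * L ≡ 3 * suc d * count Q + 3 * count (U ∖ Q)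
    ∑k-level = begin
      sum k + 3 * L
        ≡⟨ cong (λ s → sum k + s) (∑-*ˡ 3 (λ v → ⟦ Q v ⟧ * level v)) ⟨
      sum k + ∑[ v < n ] (3 * (⟦ Q v ⟧ * level v))
        ≡⟨ ∑-distrib-+ k (λ v → 3 * (⟦ Q v ⟧ * level v)) ⟨
      ∑[ v < n ] (k v + 3 * (⟦ Q v ⟧ * level v))
        ≡⟨ sum-cong-≗ k-level ⟩
      ∑[ v < n ] (3 * suc d * ⟦ Q v ⟧ + 3 * ⟦ (U ∖ Q) v ⟧)
        ≡⟨ ∑-distrib-+ (λ v → 3 * suc d * ⟦ Q v ⟧) (λ v → 3 * ⟦ (U ∖ Q) v ⟧) ⟩
      ∑[ v < n ] (3 * suc d * ⟦ Q v ⟧) + ∑[ v < n ] (3 * ⟦ (U ∖ Q) v ⟧)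
        ≡⟨ cong₂ _+_ (∑-*ˡ (3 * suc d) (⟦_⟧ ∘ Q)) (∑-*ˡ 3 (⟦_⟧ ∘ (U ∖ Q))) ⟩
      3 * suc d * sum (⟦_⟧ ∘ Q) + 3 * sum (⟦_⟧ ∘ (U ∖ Q))
        ≡⟨ cong₂ (λ a b → 3 * suc d * a + 3 * b) (count≡∑ Q) (count≡∑ (U ∖ Q)) ⟨
      3 * suc d * count Q + 3 * count (U ∖ Q) ∎
      where open ≡-Reasoning

    -- Splitting 3(d + 1) as (3d + 1) + 2 isolates the left side of `balance`; then 3`L` cancels.
    ∑k≤ : sum k * 1 ≤ count Q * suc (3 * d)
    ∑k≤ = +-cancelʳ-≤ (3 * L) _ _ (begin
      sum k * 1 + 3 * L                              ≡⟨ cong (_+ 3 * L) (*-identityʳ (sum k)) ⟩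
      sum k + 3 * L                                  ≡⟨ ∑k-level ⟩
      3 * suc d * count Q + 3 * count (U ∖ Q)
        ≡⟨ solve 3 (λ d q m → con 3 :* (con 1 :+ d) :* q :+ con 3 :* m
                          := q :* (con 1 :+ con 3 :* d) :+ (con 2 :* q :+ con 3 :* m)) refl d (count Q) (count (U ∖ Q)) ⟩
      count Q * suc (3 * d) + (2 * count Q + 3 * count (U ∖ Q))
        ≤⟨ +-monoʳ-≤ (count Q * suc (3 * d)) balance ⟩
      count Q * suc (3 * d) + 3 * L                  ∎)
      where open ≤-Reasoning

  Heavy : VSet n → Set
  Heavy R =
    ∃ λ S → (∀ {v} → v ∈ S → v ∈ R) × IsKIndependent 2 G S × weight R w ℚ.≤ (+ count S) / 1

  -- `U` contains all neighbours of `Q` in `R`, and `S` avoids `U`. Hence no edge joins `Q` to `S`,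
  -- degrees stay as they were, and both sizes and weights add up.
  extend : ∀ {R} (red : Reducible R) → Heavy (R ∖ Reducible.U red) → Heavy R
  extend {R} red (S , S⊆R∖U , S-indep , S-large) = Q∪S , (λ {v} → Q∪S⊆R {v}) , Q∪S-indep , Q∪S-large
    where
    open Reducible red

    Q∪S : VSet n
    Q∪S v = Q v ∨ S v

    S⊆R : ∀ {v} → v ∈ S → v ∈ R
    S⊆R {v} = T∧ˡ (R v) ∘ S⊆R∖U

    S⇒∉U : ∀ {v} → v ∈ S → ¬ v ∈ U
    S⇒∉U {v} = T-not⁻ ∘ T∧ʳ (R v) ∘ S⊆R∖U

    Q∪S⊆R : ∀ {v} → v ∈ Q∪S → v ∈ R
    Q∪S⊆R {v} = [ U⊆R ∘ Q⊆U , S⊆R ] ∘ T∨⁻ (Q v)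

    Q∪S-indep : IsKIndependent 2 G Q∪S
    Q∪S-indep u u∈ with T∨⁻ (Q u) u∈
    ... | inj₁ u∈Q = ≤-trans (count-mono λ v e → T∧ {Q v} (stays-in-Q v e) (T∧ʳ (Q∪S v) e)) (indep u u∈Q)
      where
      stays-in-Q : ∀ v → T (Q∪S v ∧ adj G u v) → v ∈ Q
      stays-in-Q v e with T∨⁻ (Q v) (T∧ˡ (Q∪S v) e)
      ... | inj₁ v∈Q = v∈Q
      ... | inj₂ v∈S = contradiction (closed u∈Q (S⊆R v∈S) (T∧ʳ (Q∪S v) e)) (S⇒∉U v∈S)
    ... | inj₂ u∈S = ≤-trans (count-mono λ v e → T∧ {S v} (stays-in-S v e) (T∧ʳ (Q∪S v) e)) (S-indep u u∈S)
      where
      stays-in-S : ∀ v → T (Q∪S v ∧ adj G u v) → v ∈ S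
      stays-in-S v e with T∨⁻ (Q v) (T∧ˡ (Q∪S v) e)
      ... | inj₁ v∈Q = contradiction (closed v∈Q (S⊆R u∈S) (adj-symT (T∧ʳ (Q∪S v) e))) (S⇒∉U u∈S)
      ... | inj₂ v∈S = v∈S

    |Q|+|S|≤ : count Q + count S ≤ count Q∪S
    |Q|+|S|≤ = begin
      count Q + count S            ≤⟨ +-monoʳ-≤ (count Q) (count-mono λ v v∈S →
                                        T∧ (T∨⁺ (Q v) (inj₂ v∈S)) (T-not⁺ (S⇒∉U v∈S ∘ Q⊆U))) ⟩
      count Q + count (Q∪S ∖ Q)    ≡⟨ count-∖ (λ v v∈Q → T∨⁺ (Q v) (inj₁ v∈Q)) ⟨
      count Q∪S                    ∎
      where open ≤-Reasoning

    Q∪S-large : weight R w ℚ.≤ (+ count Q∪S) / 1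
    Q∪S-large = begin
      weight R w                           ≡⟨ weight-∖ w U⊆R ⟩
      weight U w ℚ.+ weight (R ∖ U) w      ≤⟨ ℚ.+-mono-≤ (weight-reducible red) S-large ⟩
      (+ count Q) / 1 ℚ.+ (+ count S) / 1  ≡⟨ /-+-/ (count Q) (count S) 0 ⟩
      (+ (count Q + count S)) / 1          ≤⟨ /-mono-≤ (count Q + count S) 0 (count Q∪S) 0 (*-monoˡ-≤ 1 |Q|+|S|≤) ⟩
      (+ count Q∪S) / 1                    ∎
      where open ℚ.≤-Reasoning

  -- Without a bad vertex `R` has maximum degree at most 1 and serves as `S` itself, each weight
  -- being at most 1. Otherwise the first bad vertex yields a reduction.
  heavy : ∀ k R → count R ≤ k → Heavy R
  heavy k R |R|≤k with argmin (bad? R) rank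
  ... | inj₁ none = R , (λ v∈R → v∈R) ,
    (λ u u∈R → ≤-trans (count-neighbours≤1 R
      (no-bad⇒matching R R (λ v∈R → v∈R) (λ {v} _ → none v)) u u∈R) (s≤s z≤n)) ,
    weight≤count R
  ... | inj₂ (x , (x∈R , _ , _ , path) , first) = descend k |R|≤k (FirstBad.reducible R x∈R path first)
    where
    -- The bound cannot be 0 as `x` lies in `R`, and it drops by one because `U` is nonempty.
    descend : ∀ k → count R ≤ k → Reducible R → Heavy R
    descend zero    |R|≤0   _   = contradiction (≤-trans (∈⇒1≤count R x∈R) |R|≤0) λ ()
    descend (suc k) |R|≤1+k red = extend red (heavy k (R ∖ U) (≤-pred (begin
      suc (count (R ∖ U))      ≤⟨ +-monoˡ-≤ (count (R ∖ U)) (∈⇒1≤count U (proj₂ nonempty)) ⟩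
      count U + count (R ∖ U)  ≡⟨ count-∖ {P = R} {Q = U} (λ _ → U⊆R) ⟨
      count R                  ≤⟨ |R|≤1+k ⟩
      suc k                    ∎)))
      where
      open Reducible red
      open ≤-Reasoning

theorem7 : ∀ (n : ℕ) (G : Graph (suc n)) (ζ : Fin (suc n) → ℕ) (a : ℕ)
    → (∀ v → IsZeta G v (ζ v))
    → IsAlpha 2 G a
    → Z3 ζ ℚ.≤ (+ a) / 1
theorem7 n G ζ a isζ (_ , α-max) = begin
  Z3 ζ                   ≡⟨ foldr-map-tabulate (Z3term ∘ ζ) (λ v → v) ⟩
  -- Levels are at most `ζ` and the weight decreases in its argument, so replacing `ζ` by `level`
  -- only increases the sum.
  sumℚ (Z3term ∘ ζ)      ≤⟨ sumℚ-mono-≤ (λ v → Z3term-antitone (level≤ζ {v} _)) ⟩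
  sumℚ (Z3term ∘ level)  ≤⟨ S-large ⟩
  (+ count S) / 1        ≤⟨ /-mono-≤ (count S) 0 a 0 (*-monoˡ-≤ 1 (α-max S S-indep)) ⟩
  (+ a) / 1              ∎
  where
  open ℚ.≤-Reasoning
  V : VSet (suc n)
  V _ = true
  -- The peeling starts from all of V(G) with running maximum 0; the maximality in `IsZeta` bounds
  -- the minimum degrees it meets.
  open DegeneracyOrder (degeneracyOrder G ζ (λ v → proj₂ (isζ v)) (count V) V 0 ≤-refl (λ _ → z≤n))
  open Induction G rank level (rank-injective _ _) (level-mono _ _) (λ u → later-degree {u} _)
  large : Heavy V
  large = heavy (count V) V ≤-refl
  S = proj₁ large
  S-indep = proj₁ (proj₂ (proj₂ large))
  S-large = proj₂ (proj₂ (proj₂ large))
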